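{- (Gödel's Completeness Theorem for quantifier algebras.) Let $\mathbf A$ be a locally finite quantifier algebra over an infinite set $X$. (a) Let $J$ be a consistent subset of $\mathbf A_*(X)$. Then there is a $2$-model $\mathbf B$ of $\mathbf A$ and a map $\sigma:X\to\mathbf B^*(\emptyset)$ such that $p\sigma=1$ for every $p\in J$. (b) If $p,q\in\mathbf A_*(X)$ and $p\neq q$, then there is a $2$-model $\mathbf B$ of $\mathbf A$ and a map $\sigma:X\to\mathbf B^*(\emptyset)$ such that $p\sigma\neq q\sigma$.
   Context: Throughout, $\mathcal S$ is a nonempty collection of sets containing at least one infinite set; $X,Y,Z,W$ denote members of $\mathcal S$ (sets of variables). Quantifier theory. A quantifier theory $\mathbf A$ over $\mathcal S$ consists of: a set $\mathbf A^*(X)$ and a map $\epsilon_X:X\to\mathbf A^*(X)$ for each $X$ (one writes $x$ for $\epsilon_X(x)$); a Boolean algebra $\mathbf A_*(X)$ for each $X$; an element $a\sigma\in\mathbf A^*(Y)$ for each nonempty $X$, $a\in\mathbf A^*(X)$ and map $\sigma:X\to\mathbf A^*(Y)$; an element $p\sigma\in\mathbf A_*(Y)$ for each nonempty $X$, $p\in\mathbf A_*(X)$ and map $\sigma:X\to\mathbf A^*(Y)$; an element $\forall x.p\in\mathbf A_*(X)$ for each nonempty $X$, $x\in X$, $p\in\mathbf A_*(X)$. Put $\mathbf A(X)=\mathbf A_*(X)\cup\mathbf A^*(X)$. For all nonempty $X$, $x\in X$, $t\in\mathbf A(X)$, $\sigma:X\to\mathbf A^*(Y)$, $p,q\in\mathbf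 A_*(X)$ the following hold. (P1) $t\epsilon_X=t$. (P2) $(t\sigma)\tau=t(\sigma\tau)$ if $Y$ is nonempty and $\tau:Y\to\mathbf A^*(W)$, where $(\sigma\tau)(x)=\sigma(x)\tau$. (P3) $x\sigma=\sigma(x)$. (P4) $p\mapsto p\sigma$ is a homomorphism of Boolean algebras $\mathbf A_*(X)\to\mathbf A_*(Y)$. (P5) $(\forall x.p)\sigma=\forall y.(p\sigma^{y/x})$ whenever $y,z\in Y$, $y\ne z$ and $\sigma[z/y]=\sigma$. (Q1) $\forall x.(p\wedge q)=\forall x.p\wedge\forall x.q$. (Q2) $\forall x.p\le p$. (Q3) $\forall x.p=p$ if $p[y/x]=p$ for some $y\in X$, $y\neq x$. Notation: for $y\in Y$ and $d\in\mathbf A^*(Y)$, $[d/y]:Y\to\mathbf A^*(Y)$ sends $y$ to $d$ and every other variable to itself; for $d\in \mathbf A^*(Y)$, $\sigma^{d/x}:X\to\mathbf A^*(Y)$ sends $x$ to $d$ and agrees with $\sigma$ elsewhere. A quantifier algebra over $X$ is a quantifier theory over $\mathcal S=\{X\}$. Supports. For nonempty $X$ and $t\in\mathbf A(X)$, a subset $U\subseteq X$ is a support for $t$ if $t\sigma=t\tau$ for all $Y$ and all $\sigma,\tau:X\to\mathbf A^*(Y)$ with $\sigma|_U=\tau|_U$; $t$ is closed if $\emptyset$ is a support for $t$ (elements of $\mathbf A(\emptyset)$ are by definition closed). $\mathbf A$ is locally finite if every element of every $\mathbf A(X)$ has a finite support. Standing convention: every quantifier theory considered is nontrivial, meaning that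 $\mathbf A_*(X)$ has a non-closed element for some nonempty $X\in\mathcal S$. Models. A quantifier model is a quantifier theory $\mathbf B$ over a collection containing $\emptyset$ such that (M1) $\mathbf B^*(\emptyset)\neq\emptyset$ and $\mathbf B_*(\emptyset)$ is a nontrivial Boolean algebra ($0\ne1$); (M2) for nonempty $X$, $x\in X$, $p\in\mathbf B_*(X)$, $\sigma:X\to\mathbf B^*(\emptyset)$, the infimum $\bigwedge_{d\in\mathbf B^*(\emptyset)}p\sigma^{d/x}$ exists in $\mathbf B_*(\emptyset)$ and equals $(\forall x.p)\sigma$. It is a $2$-model if $\mathbf B_*(\emptyset)=2=\{0,1\}$. A $2$-model of a quantifier theory $\mathbf A$ over $\mathcal S$ is a $2$-model $\mathbf B$ over $\mathcal S\cup\{\emptyset\}$ whose restriction to $\mathcal S\setminus\{\emptyset\}$ equals that of $\mathbf A$. A subset of a Boolean algebra is consistent if it is contained in a proper filter (equivalently, finite meets of its elements are nonzero). -}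

module Defs where

open import Algebra.Lattice.Bundles using (BooleanAlgebra)
open import Algebra.Lattice.Morphism.Structures using (module LatticeMorphisms)
import Algebra.Lattice.Properties.Lattice as LatticeProperties
open import Data.Empty using (⊥-elim)
import Data.Empty.Polymorphic as Poly
open import Data.List.Base using (List; [])
open import Data.List.Membership.Propositional using (_∈_)
open import Data.Maybe.Base using (Maybe; just; nothing)
open import Data.Product.Base using (Σ; ∃; _×_; _,_; proj₁)
open import Data.Sum.Base using (_⊎_)
import Data.Unit.Polymorphic as Poly
open import Level using (Level; suc; _⊔_)
open import Relation.Binary.Bundles using (Poset; Setoid)
open import Relation.Binary.Definitions using (DecidableEquality)
open import Relation.Binary.PropositionalEquality using (_≡_; _≢_; sym; subst)
open import Relation.Nullary using (¬_; yes; no)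
open import Relation.Unary using (Pred; U; ∅)

private
  variable
    a b c ℓ ℓ₁ ℓ₂ : Level

------------------------------------------------------------------------
-- Sets

-- Proofs of a negation are definitionally equal, so nothing that takes
-- a proof of NonEmpty as an argument can depend on which proof it is.

NonEmpty : Set a → Set a
NonEmpty X = ¬ ¬ X

FiniteSubset : {X : Set a} → Pred X ℓ → Set (a ⊔ ℓ)
FiniteSubset {X = X} P = ∃ λ (xs : List X) → ∀ x → P x → x ∈ xs

Infinite : Set a → Set a
Infinite X = ¬ FiniteSubset {X = X} U

infinite⇒nonEmpty : {X : Set a} → Infinite X → NonEmpty X
infinite⇒nonEmpty inf empty = inf ([] , λ x _ → ⊥-elim (empty x))

-- Zorn's lemma, the form in which the axiom of choice is assumed.

ZornsLemma : ∀ c ℓ₁ ℓ₂ ℓ → Set (suc (c ⊔ ℓ₁ ⊔ ℓ₂ ⊔ ℓ))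
ZornsLemma c ℓ₁ ℓ₂ ℓ =
  (P : Poset c ℓ₁ ℓ₂) → let open Poset P in
  ((C : Pred Carrier ℓ) →
    (∀ x y → C x → C y → (x ≤ y) ⊎ (y ≤ x)) →
    ∃ λ u → ∀ x → C x → x ≤ u) →
  ∃ λ m → ∀ x → m ≤ x → x ≈ m

------------------------------------------------------------------------
-- Boolean algebras

module _ (B : BooleanAlgebra c ℓ) where
  open BooleanAlgebra B using (Carrier; _≈_; _∧_; ⊤; ⊥; lattice)
  open Poset (LatticeProperties.poset lattice) using (_≤_)

  IsInfimum : {I : Set a} → (I → Carrier) → Carrier → Set (a ⊔ c ⊔ ℓ)
  IsInfimum f m = (∀ i → m ≤ f i) × (∀ l → (∀ i → l ≤ f i) → l ≤ m)

  IsTwo : Set (c ⊔ ℓ)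
  IsTwo = ¬ (⊤ ≈ ⊥) × (∀ p → (p ≈ ⊤) ⊎ (p ≈ ⊥))

  record IsProperFilter (F : Pred Carrier a) : Set (a ⊔ c ⊔ ℓ) where
    field
      ⊤-closed : F ⊤
      ∧-closed : ∀ {p q} → F p → F q → F (p ∧ q)
      ≤-closed : ∀ {p q} → p ≤ q → F p → F q
      proper   : ¬ F ⊥

  Consistent : Pred Carrier a → Set (suc a ⊔ c ⊔ ℓ)
  Consistent {a} J =
    ∃ λ (F : Pred Carrier a) → IsProperFilter F × (∀ p → J p → F p)

record IsBooleanAlgebraHomomorphism
    (B : BooleanAlgebra a ℓ₁) (C : BooleanAlgebra b ℓ₂)
    (f : BooleanAlgebra.Carrier B → BooleanAlgebra.Carrier C)
    : Set (a ⊔ ℓ₁ ⊔ ℓ₂) where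
  private
    module B = BooleanAlgebra B
    module C = BooleanAlgebra C
  open LatticeMorphisms B.rawLattice C.rawLattice using (IsLatticeHomomorphism)
  field
    isLatticeHomomorphism : IsLatticeHomomorphism f
    ¬-homo                : ∀ p → f (B.¬ p) C.≈ C.¬ (f p)
    ⊤-homo                : f B.⊤ C.≈ C.⊤
    ⊥-homo                : f B.⊥ C.≈ C.⊥

------------------------------------------------------------------------
-- Collections of sets of variables

-- The equality test is what σ^{d/x} is defined from.

record Collection ℓ : Set (suc ℓ) where
  field
    Index : Set ℓ
    Var   : Index → Set ℓ
    _≟_   : ∀ {i} → DecidableEquality (Var i)

｛_｝ : (X : Set ℓ) → DecidableEquality X → Collection ℓ
｛ X ｝ _≟_ = record { Index = Poly.⊤ ; Var = λ _ → X ; _≟_ = _≟_ }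

reindex : (S : Collection ℓ) {I : Set ℓ} → (I → Collection.Index S) → Collection ℓ
reindex S {I} f = record { Index = I ; Var = λ i → Var (f i) ; _≟_ = _≟_ }
  where open Collection S

module _ (S : Collection ℓ) where
  open Collection S

  NonEmptyIndex : Set ℓ
  NonEmptyIndex = Σ Index λ i → NonEmpty (Var i)

  -- S ∪ {∅}; the empty members of S are dropped, so that ∅ occurs once.

  adjoin∅ : Collection ℓ
  adjoin∅ = record { Index = Maybe NonEmptyIndex ; Var = Var′ ; _≟_ = λ {i} → dec i }
    where
    Var′ : Maybe NonEmptyIndex → Set ℓ
    Var′ (just i) = Var (proj₁ i)
    Var′ nothing  = Poly.⊥

    dec : ∀ i → DecidableEquality (Var′ i)
    dec (just i) = _≟_
    dec nothing  ()

------------------------------------------------------------------------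
-- Quantifier theories

record Structure (S : Collection ℓ) : Set (suc ℓ) where
  open Collection S
  field
    terms    : Index → Setoid ℓ ℓ
    formulas : Index → BooleanAlgebra ℓ ℓ

  Term : Index → Set ℓ
  Term i = Setoid.Carrier (terms i)

  Formula : Index → Set ℓ
  Formula i = BooleanAlgebra.Carrier (formulas i)

  field
    var    : ∀ {i} → Var i → Term i
    substᵗ : ∀ {i j} → NonEmpty (Var i) → Term i → (Var i → Term j) → Term j
    substᶠ : ∀ {i j} → NonEmpty (Var i) → Formula i → (Var i → Term j) → Formula j
    all    : ∀ {i} → Var i → Formula i → Formula i

  module _ {i : Index} where
    open Setoid (terms i) public using () renaming (_≈_ to _≈ᵗ_)
    open BooleanAlgebra (formulas i) public using (_∧_) renaming (_≈_ to _≈ᶠ_)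
    open Poset (LatticeProperties.poset (BooleanAlgebra.lattice (formulas i))) public
      using (_≤_)

  module _ {i j : Index} where

    infix 4 _≗ᵗ_
    _≗ᵗ_ : (σ τ : Var i → Term j) → Set ℓ
    σ ≗ᵗ τ = ∀ x → σ x ≈ᵗ τ x

    -- update σ x d is σ^{d/x}

    update : (Var i → Term j) → Var i → Term j → (Var i → Term j)
    update σ x d y with y ≟ x
    ... | yes _ = d
    ... | no  _ = σ y

    compose : ∀ {k} → NonEmpty (Var j) →
              (Var i → Term j) → (Var j → Term k) → (Var i → Term k)
    compose ne σ τ x = substᵗ ne (σ x) τ

  -- [ d / y ]

  [_/_] : ∀ {i} → Term i → Var i → (Var i → Term i)
  [ d / y ] = update var y d

  module _ {i : Index} (ne : NonEmpty (Var i)) where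

    IsSupportᵗ : Pred (Var i) ℓ → Term i → Set ℓ
    IsSupportᵗ V t = ∀ {j} (σ τ : Var i → Term j) →
      (∀ x → V x → σ x ≈ᵗ τ x) → substᵗ ne t σ ≈ᵗ substᵗ ne t τ

    IsSupportᶠ : Pred (Var i) ℓ → Formula i → Set ℓ
    IsSupportᶠ V p = ∀ {j} (σ τ : Var i → Term j) →
      (∀ x → V x → σ x ≈ᵗ τ x) → substᶠ ne p σ ≈ᶠ substᶠ ne p τ

    Closedᶠ : Formula i → Set ℓ
    Closedᶠ = IsSupportᶠ λ _ → Poly.⊥

  LocallyFinite : Set (suc ℓ)
  LocallyFinite = ∀ {i} (ne : NonEmpty (Var i)) →
    (∀ t → ∃ λ V → FiniteSubset V × IsSupportᵗ ne V t) ×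
    (∀ p → ∃ λ V → FiniteSubset V × IsSupportᶠ ne V p)

  Nontrivial : Set ℓ
  Nontrivial = ∃ λ i → Σ (NonEmpty (Var i)) λ ne → ∃ λ p → ¬ Closedᶠ {i} ne p

record IsQuantifierTheory {S : Collection ℓ} (A : Structure S) : Set ℓ where
  open Collection S
  open Structure A
  field
    substᵗ-cong : ∀ {i j} (ne : NonEmpty (Var i)) {t u} {σ τ : Var i → Term j} →
                  t ≈ᵗ u → σ ≗ᵗ τ → substᵗ ne t σ ≈ᵗ substᵗ ne u τ
    substᶠ-cong : ∀ {i j} (ne : NonEmpty (Var i)) {p q} {σ τ : Var i → Term j} →
                  p ≈ᶠ q → σ ≗ᵗ τ → substᶠ ne p σ ≈ᶠ substᶠ ne q τ
    all-cong    : ∀ {i} (x : Var i) {p q} → p ≈ᶠ q → all x p ≈ᶠ all x q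

    P1ᵗ : ∀ {i} (ne : NonEmpty (Var i)) t → substᵗ ne t var ≈ᵗ t
    P1ᶠ : ∀ {i} (ne : NonEmpty (Var i)) p → substᶠ ne p var ≈ᶠ p

    P2ᵗ : ∀ {i j k} (neᵢ : NonEmpty (Var i)) (neⱼ : NonEmpty (Var j))
          t (σ : Var i → Term j) (τ : Var j → Term k) →
          substᵗ neⱼ (substᵗ neᵢ t σ) τ ≈ᵗ substᵗ neᵢ t (compose neⱼ σ τ)
    P2ᶠ : ∀ {i j k} (neᵢ : NonEmpty (Var i)) (neⱼ : NonEmpty (Var j))
          p (σ : Var i → Term j) (τ : Var j → Term k) →
          substᶠ neⱼ (substᶠ neᵢ p σ) τ ≈ᶠ substᶠ neᵢ p (compose neⱼ σ τ)

    P3 : ∀ {i j} (ne : NonEmpty (Var i)) x (σ : Var i → Term j) →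
         substᵗ ne (var x) σ ≈ᵗ σ x

    P4 : ∀ {i j} (ne : NonEmpty (Var i)) (σ : Var i → Term j) →
         IsBooleanAlgebraHomomorphism (formulas i) (formulas j) (λ p → substᶠ ne p σ)

    P5 : ∀ {i j} (neᵢ : NonEmpty (Var i)) (neⱼ : NonEmpty (Var j))
         x p (σ : Var i → Term j) (y z : Var j) → y ≢ z →
         compose neⱼ σ [ var z / y ] ≗ᵗ σ →
         substᶠ neᵢ (all x p) σ ≈ᶠ all y (substᶠ neᵢ p (update σ x (var y)))

    Q1 : ∀ {i} (x : Var i) p q → all x (p ∧ q) ≈ᶠ (all x p ∧ all x q)
    Q2 : ∀ {i} (x : Var i) p → all x p ≤ p
    Q3 : ∀ {i} (ne : NonEmpty (Var i)) (x y : Var i) p → y ≢ x →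
         substᶠ ne p [ var y / x ] ≈ᶠ p → all x p ≈ᶠ p

-- Every quantifier theory is understood to be nontrivial.

record QuantifierTheory (S : Collection ℓ) : Set (suc ℓ) where
  field
    structure          : Structure S
    isQuantifierTheory : IsQuantifierTheory structure
    nontrivial         : Structure.Nontrivial structure

  open Structure structure public
  open IsQuantifierTheory isQuantifierTheory public

QuantifierAlgebra : (X : Set ℓ) → DecidableEquality X → Set (suc ℓ)
QuantifierAlgebra X _≟_ = QuantifierTheory (｛ X ｝ _≟_)

restrict : {S : Collection ℓ} {I : Set ℓ} (f : I → Collection.Index S) →
           Structure S → Structure (reindex S f)
restrict f A = record
  { terms    = λ i → terms (f i)
  ; formulas = λ i → formulas (f i)
  ; var      = var
  ; substᵗ   = substᵗ
  ; substᶠ   = substᶠ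
  ; all      = all
  }
  where open Structure A

------------------------------------------------------------------------
-- Models

record IsQuantifierModel {S : Collection ℓ} (B : QuantifierTheory S)
                         (o : Collection.Index S) : Set ℓ where
  open Collection S
  open QuantifierTheory B
  field
    Var-empty : ¬ Var o
    M1ᵗ       : NonEmpty (Term o)
    M1ᶠ       : ¬ (BooleanAlgebra.⊤ (formulas o) ≈ᶠ BooleanAlgebra.⊥ (formulas o))
    M2        : ∀ {i} (ne : NonEmpty (Var i)) x p (σ : Var i → Term o) →
                IsInfimum (formulas o)
                  (λ (d : Term o) → substᶠ ne p (update σ x d))
                  (substᶠ ne (all x p) σ)

record TwoModel {S : Collection ℓ} (A : QuantifierTheory S) : Set (suc ℓ) where
  open Collection S
  private module A = QuantifierTheory A
  field
    theory : QuantifierTheory (adjoin∅ S)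

  private module B = QuantifierTheory theory

  field
    isQuantifierModel : IsQuantifierModel theory nothing
    isTwo             : IsTwo (B.formulas nothing)
    restriction       : restrict just B.structure ≡ restrict proj₁ A.structure

  Domain : Set ℓ
  Domain = B.Term nothing

  truthValues : BooleanAlgebra ℓ ℓ
  truthValues = B.formulas nothing

  open BooleanAlgebra truthValues public
    using () renaming (Carrier to TruthValue; _≈_ to _≈ᵛ_; ⊤ to 𝟏)

  -- p σ, for p a formula of A regarded as a formula of the model

  value : ∀ {i} → NonEmpty (Var i) → A.Formula i → (Var i → Domain) → TruthValue
  value {i} ne p = B.substᶠ {just (i , ne)} ne
    (subst (λ R → Structure.Formula R (i , ne)) (sym restriction) p)

{-# OPTIONS --safe #-}
module Submission where

-- The domain consists of terms over X together with a new constant for every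
-- pair of a variable x and a formula p with parameters in the domain; since the
-- domain is an inductive type, the constants need no iteration.  Once terms are
-- assigned to the new constants, domain elements evaluate to terms over X, so a
-- formula with parameters is a function from assignments to A_*(X), and these
-- functions form a power of the Boolean algebra A_*(X).  In that power, the
-- given filter and the axioms p σ^{d/x} → (∀x.p) σ, with d the constant
-- belonging to x and p, generate a proper filter: finitely many constants
-- can be sent, in order of dependency, to fresh variables.  An ultrafilter above
-- it decides the truth values.

open import Defs
open import Algebra.Lattice.Bundles using (BooleanAlgebra)
open import Algebra.Lattice.Morphism.Structures using (module LatticeMorphisms)
import Algebra.Lattice.Properties.BooleanAlgebra as BooleanAlgebraProperties
open import Axiom.ExcludedMiddle using (ExcludedMiddle)
open import Data.Bool.Base using (true; false) renaming (_∧_ to _∧ᵇ_)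
open import Data.Bool.Properties using (∨-∧-booleanAlgebra)
open import Data.Empty using (⊥-elim)
open import Data.List.Base using (List; []; _∷_; _++_; concatMap)
open import Data.List.Membership.Propositional using (_∈_; _∉_)
open import Data.List.Membership.Propositional.Properties
  using (∈-++⁺ˡ; ∈-++⁺ʳ; ∈-concatMap⁺)
open import Data.List.Relation.Binary.Subset.Propositional using () renaming (_⊆_ to _⊆ˡ_)
open import Data.List.Relation.Unary.Any as Any using (here; there)
open import Data.Maybe.Base using (just; nothing)
open import Data.Product.Base using (Σ; ∃; _×_; _,_; proj₁; proj₂)
open import Data.Sum.Base using (_⊎_; inj₁; inj₂)
open import Data.Unit.Polymorphic as Poly using (tt)
open import Function.Base using (_∘_; id)
open import Level using (Level; Lift; lift; suc; _⊔_)
open import Relation.Binary.Bundles using (Poset; Setoid)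
import Relation.Binary.Lattice as OrderTheoretic
open import Relation.Binary.PropositionalEquality using (_≡_; _≢_; refl; sym)
import Relation.Binary.Reasoning.Setoid as SetoidReasoning
open import Relation.Nullary using (¬_; yes; no; does; True; toWitness; fromWitness)
open import Relation.Nullary.Decidable using (decidable-stable)
open import Relation.Unary using (Pred; _⊆_)

private
  variable
    a c ℓ ℓ₁ ℓ₂ : Level

-- Boolean algebras: order, principal filters, powers

module BooleanAlgebraHomomorphism {B : BooleanAlgebra a ℓ₁} {C : BooleanAlgebra c ℓ₂} {f}
                                  (f-homo : IsBooleanAlgebraHomomorphism B C f) where
  open IsBooleanAlgebraHomomorphism f-homo public
  open LatticeMorphisms.IsLatticeHomomorphism isLatticeHomomorphism public

module Order (B : BooleanAlgebra c ℓ) where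
  open BooleanAlgebra B public
    renaming (¬_ to ∁_; refl to ≈-refl; sym to ≈-sym; trans to ≈-trans; ¬-cong to ∁-cong)
  open BooleanAlgebraProperties B public
    using (∧-identityʳ; ∨-identityʳ; ∧-zeroˡ; deMorgan₂; ¬-involutive;
           poset; ∨-∧-orderTheoreticLattice)
  open Poset poset public
    using (_≤_) renaming (refl to ≤-refl; trans to ≤-trans; reflexive to ≤-reflexive;
                          antisym to ≤-antisym)
  open OrderTheoretic.Lattice ∨-∧-orderTheoreticLattice public
    using (x∧y≤x; x∧y≤y; ∧-greatest; x≤x∨y; y≤x∨y)

  ∧-mono : ∀ {p q r s} → p ≤ q → r ≤ s → (p ∧ r) ≤ (q ∧ s)
  ∧-mono p≤q r≤s = ∧-greatest (≤-trans (x∧y≤x _ _) p≤q) (≤-trans (x∧y≤y _ _) r≤s)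

  ⊥-minimum : ∀ p → ⊥ ≤ p
  ⊥-minimum p = ≈-sym (∧-zeroˡ p)

  ⊤-maximum : ∀ p → p ≤ ⊤
  ⊤-maximum p = ≈-sym (∧-identityʳ p)

  ≤⊥⇒≈⊥ : ∀ {p} → p ≤ ⊥ → p ≈ ⊥
  ≤⊥⇒≈⊥ p≤⊥ = ≤-antisym p≤⊥ (⊥-minimum _)

  ∧∁≈⊥⇒≤ : ∀ {p q} → (p ∧ ∁ q) ≈ ⊥ → p ≤ q
  ∧∁≈⊥⇒≤ {p} {q} eq = begin
    p                    ≈⟨ ∧-identityʳ p ⟨
    p ∧ ⊤                ≈⟨ ∧-congˡ (∨-complementʳ q) ⟨
    p ∧ (q ∨ ∁ q)        ≈⟨ ∧-distribˡ-∨ p q (∁ q) ⟩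
    (p ∧ q) ∨ (p ∧ ∁ q)  ≈⟨ ∨-congˡ eq ⟩
    (p ∧ q) ∨ ⊥          ≈⟨ ∨-identityʳ _ ⟩
    p ∧ q                ∎
    where open SetoidReasoning setoid

  ∧≤⊥⇒≤∁ : ∀ {p q} → (p ∧ q) ≤ ⊥ → p ≤ (∁ q)
  ∧≤⊥⇒≤∁ {p} {q} p∧q≤⊥ =
    ∧∁≈⊥⇒≤ (≈-trans (∧-congˡ (¬-involutive q)) (≤⊥⇒≈⊥ p∧q≤⊥))

  principal : ∀ {p} → ¬ (p ≈ ⊥) → IsProperFilter B (p ≤_)
  principal p≉⊥ = record
    { ⊤-closed = ⊤-maximum _
    ; ∧-closed = ∧-greatest
    ; ≤-closed = λ q≤r p≤q → ≤-trans p≤q q≤r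
    ; proper   = λ p≤⊥ → p≉⊥ (≤⊥⇒≈⊥ p≤⊥)
    }

-- Since the operations are pointwise, so is the induced order, and an inequality in the power can
-- be proved one index at a time.
power : Set a → BooleanAlgebra c ℓ → BooleanAlgebra (a ⊔ c) (a ⊔ ℓ)
power I B = record
  { Carrier = I → Carrier
  ; _≈_ = λ f g → ∀ i → f i ≈ g i
  ; _∨_ = λ f g i → f i ∨ g i
  ; _∧_ = λ f g i → f i ∧ g i
  ; ¬_  = λ f i → ∁ f i
  ; ⊤   = λ _ → ⊤
  ; ⊥   = λ _ → ⊥
  ; isBooleanAlgebra = record
    { isDistributiveLattice = record
      { isLattice = record
        { isEquivalence = record
          { refl  = λ _ → ≈-refl
          ; sym   = λ p i → ≈-sym (p i)
          ; trans = λ p q i → ≈-trans (p i) (q i)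
          }
        ; ∨-comm     = λ f g i → ∨-comm (f i) (g i)
        ; ∨-assoc    = λ f g h i → ∨-assoc (f i) (g i) (h i)
        ; ∨-cong     = λ p q i → ∨-cong (p i) (q i)
        ; ∧-comm     = λ f g i → ∧-comm (f i) (g i)
        ; ∧-assoc    = λ f g h i → ∧-assoc (f i) (g i) (h i)
        ; ∧-cong     = λ p q i → ∧-cong (p i) (q i)
        ; absorptive = (λ f g i → ∨-absorbs-∧ (f i) (g i))
                     , (λ f g i → ∧-absorbs-∨ (f i) (g i))
        }
      ; ∨-distrib-∧ = (λ f g h i → ∨-distribˡ-∧ (f i) (g i) (h i))
                    , (λ f g h i → ∨-distribʳ-∧ (f i) (g i) (h i))
      ; ∧-distrib-∨ = (λ f g h i → ∧-distribˡ-∨ (f i) (g i) (h i))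
                    , (λ f g h i → ∧-distribʳ-∨ (f i) (g i) (h i))
      }
    ; ∨-complement = (λ f i → ∨-complementˡ (f i)) , (λ f i → ∨-complementʳ (f i))
    ; ∧-complement = (λ f i → ∧-complementˡ (f i)) , (λ f i → ∧-complementʳ (f i))
    ; ¬-cong       = λ p i → ∁-cong (p i)
    }
  }
  where open Order B

-- The power along a one-element type only raises the universe level.

𝟚 : ∀ {ℓ} → BooleanAlgebra ℓ ℓ
𝟚 = power Poly.⊤ ∨-∧-booleanAlgebra

module 𝟚 {ℓ} = Order (𝟚 {ℓ})

𝟚-isTwo : IsTwo (𝟚 {ℓ})
𝟚-isTwo = (λ ⊤≈⊥ → true≢false (⊤≈⊥ tt)) , λ p → split p (p tt) refl
  where
  true≢false : true ≢ false
  true≢false ()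

  split : ∀ p b → p tt ≡ b → (p 𝟚.≈ 𝟚.⊤) ⊎ (p 𝟚.≈ 𝟚.⊥)
  split p true  eq = inj₁ λ _ → eq
  split p false eq = inj₂ λ _ → eq

𝟚-≤ : (p q : 𝟚.Carrier {ℓ}) → (p tt ≡ true → q tt ≡ true) → p 𝟚.≤ q
𝟚-≤ p q h _ = lemma (p tt) (q tt) h
  where
  lemma : ∀ b b′ → (b ≡ true → b′ ≡ true) → b ≡ b ∧ᵇ b′
  lemma true  b′ h = sym (h refl)
  lemma false b′ h = refl

-- Ultrafilters

module Ultrafilter (em : ∀ {ℓ} → ExcludedMiddle ℓ)
                   (zorn : ∀ {c ℓ₁ ℓ₂ ℓ} → ZornsLemma c ℓ₁ ℓ₂ ℓ)
                   {ℓ} (B : BooleanAlgebra ℓ ℓ) where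
  open Order B

  record IsUltrafilter (F : Pred Carrier ℓ) : Set (suc ℓ) where
    field
      isProperFilter : IsProperFilter B F
      prime          : ∀ p → F p ⊎ F (∁ p)

    open IsProperFilter isProperFilter public

    ∁-excludes : ∀ {p} → F p → ¬ F (∁ p)
    ∁-excludes {p} Fp F∁p = proper (≤-closed (≤-reflexive (∧-complementʳ p)) (∧-closed Fp F∁p))

    -- This is the quotient map by the ultrafilter. It is a homomorphism to `𝟚` because exactly one
    -- of `p` and `∁ p` belongs to `F`.
    χ : Carrier → 𝟚.Carrier {ℓ}
    χ p _ = does (em {P = F p})

    χ-true : ∀ {p} → F p → χ p 𝟚.≈ 𝟚.⊤
    χ-true {p} Fp _ with em {P = F p}
    ... | yes _  = refl
    ... | no ¬Fp = ⊥-elim (¬Fp Fp)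

    χ-false : ∀ {p} → ¬ F p → χ p 𝟚.≈ 𝟚.⊥
    χ-false {p} ¬Fp _ with em {P = F p}
    ... | yes Fp = ⊥-elim (¬Fp Fp)
    ... | no _   = refl

    χ-true⁻¹ : ∀ {p} → χ p tt ≡ true → F p
    χ-true⁻¹ {p} eq with em {P = F p}
    ... | yes Fp = Fp

    χ-equiv : ∀ {p q} → (F p → F q) → (F q → F p) → χ p 𝟚.≈ χ q
    χ-equiv {p} {q} to from with em {P = F p}
    ... | yes Fp = 𝟚.≈-sym {x = χ q} {y = 𝟚.⊤} (χ-true (to Fp))
    ... | no ¬Fp = 𝟚.≈-sym {x = χ q} {y = 𝟚.⊥} (χ-false (¬Fp ∘ from))

    χ-cong : ∀ {p q} → p ≈ q → χ p 𝟚.≈ χ q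
    χ-cong p≈q = χ-equiv (≤-closed (≤-reflexive p≈q)) (≤-closed (≤-reflexive (≈-sym p≈q)))

    χ-∧ : ∀ p q → χ (p ∧ q) 𝟚.≈ (χ p 𝟚.∧ χ q)
    χ-∧ p q i with em {P = F p} | em {P = F q}
    ... | yes Fp | yes Fq = χ-true (∧-closed Fp Fq) i
    ... | yes _  | no ¬Fq = χ-false (λ h → ¬Fq (≤-closed (x∧y≤y p q) h)) i
    ... | no ¬Fp | _      = χ-false (λ h → ¬Fp (≤-closed (x∧y≤x p q) h)) i

    χ-∁ : ∀ p → χ (∁ p) 𝟚.≈ (𝟚.∁ χ p)
    χ-∁ p i with em {P = F p} | prime p
    ... | yes Fp | _        = χ-false (∁-excludes Fp) i
    ... | no ¬Fp | inj₁ Fp  = ⊥-elim (¬Fp Fp)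
    ... | no ¬Fp | inj₂ F∁p = χ-true F∁p i

    χ-∨ : ∀ p q → χ (p ∨ q) 𝟚.≈ (χ p 𝟚.∨ χ q)
    χ-∨ p q i with em {P = F p} | em {P = F q} | prime p | prime q
    ... | yes Fp | _ | _ | _ = χ-true (≤-closed (x≤x∨y p q) Fp) i
    ... | no _ | yes Fq | _ | _ = χ-true (≤-closed (y≤x∨y p q) Fq) i
    ... | no ¬Fp | no _ | inj₁ Fp | _ = ⊥-elim (¬Fp Fp)
    ... | no _ | no ¬Fq | inj₂ _ | inj₁ Fq = ⊥-elim (¬Fq Fq)
    -- Neither element belongs to `F`, so both complements do, and their meet is the complement of
    -- the join by De Morgan.
    ... | no _ | no _ | inj₂ F∁p | inj₂ F∁q =
      χ-false (λ h → ∁-excludes h (≤-closed (≤-reflexive (≈-sym (deMorgan₂ p q)))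
                                            (∧-closed F∁p F∁q))) i

  module _ (F : Pred Carrier ℓ) (isProperFilter : IsProperFilter B F) where
    private
      module F = IsProperFilter isProperFilter

      Extension : Set (suc ℓ)
      Extension = Σ (Pred Carrier ℓ) λ G → IsProperFilter B G × F ⊆ G

      extensions : Poset (suc ℓ) ℓ ℓ
      extensions = record
        { Carrier = Extension
        ; _≈_ = λ (G , _) (H , _) → (G ⊆ H) × (H ⊆ G)
        ; _≤_ = λ (G , _) (H , _) → G ⊆ H
        ; isPartialOrder = record
          { isPreorder = record
            { isEquivalence = record
              { refl  = id , id
              ; sym   = λ (p , q) → q , p
              ; trans = λ (p , q) (r , s) → (λ z → r (p z)) , (λ z → q (s z))
              }
            ; reflexive = proj₁
            ; trans = λ p q z → q (p z)
            }
          ; antisym = _,_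
          }
        }

      module Chain (C : Pred Extension ℓ)
                   (total : ∀ G H → C G → C H → (proj₁ G ⊆ proj₁ H) ⊎ (proj₁ H ⊆ proj₁ G))
                   where

        -- `F` is thrown into the union so that the empty chain has an upper bound as well.
        _∈⋃ : Pred Carrier (suc ℓ)
        p ∈⋃ = F p ⊎ ∃ λ G → C G × proj₁ G p

        -- Closure under meets requires both elements to lie in one filter. Totality of the chain
        -- selects the larger of the two members, and any member absorbs `F`.
        filterOf : ∀ {p q} → p ∈⋃ → q ∈⋃ →
                   ∃ λ H → IsProperFilter B H × H p × H q × (∀ {r} → H r → r ∈⋃)
        filterOf (inj₁ p) (inj₁ q) = F , isProperFilter , p , q , inj₁
        filterOf (inj₁ p) (inj₂ (G@(_ , isG , F⊆G) , CG , q)) =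
          _ , isG , F⊆G p , q , λ r → inj₂ (G , CG , r)
        filterOf (inj₂ (G@(_ , isG , F⊆G) , CG , p)) (inj₁ q) =
          _ , isG , p , F⊆G q , λ r → inj₂ (G , CG , r)
        filterOf (inj₂ (G@(_ , isG , _) , CG , p)) (inj₂ (H@(_ , isH , _) , CH , q))
          with total G H CG CH
        ... | inj₁ G⊆H = _ , isH , G⊆H p , q , λ r → inj₂ (H , CH , r)
        ... | inj₂ H⊆G = _ , isG , p , H⊆G q , λ r → inj₂ (G , CG , r)

        -- Excluded middle brings the union down to the level of its members.

        ⋃ : Pred Carrier ℓ
        ⋃ p = Lift ℓ (True (em {P = p ∈⋃}))

        into : ∀ {p} → p ∈⋃ → ⋃ p
        into h = lift (fromWitness h)

        out : ∀ {p} → ⋃ p → p ∈⋃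
        out (lift h) = toWitness h

        ⋃-isProperFilter : IsProperFilter B ⋃
        ⋃-isProperFilter = record
          { ⊤-closed = into (inj₁ F.⊤-closed)
          ; ∧-closed = λ {p} {q} hp hq →
              let (_ , isH , p∈H , q∈H , incl) = filterOf (out {p} hp) (out {q} hq)
              in into (incl (IsProperFilter.∧-closed isH p∈H q∈H))
          ; ≤-closed = λ {p} p≤q hp →
              let (_ , isH , p∈H , _ , incl) = filterOf (out {p} hp) (out {p} hp)
              in into (incl (IsProperFilter.≤-closed isH p≤q p∈H))
          ; proper   = λ h →
              let (_ , isH , ⊥∈H , _) = filterOf (out {⊥} h) (out {⊥} h)
              in IsProperFilter.proper isH ⊥∈H
          }

      maximal : ∃ λ M → ∀ G → proj₁ M ⊆ proj₁ G → (proj₁ G ⊆ proj₁ M) × (proj₁ M ⊆ proj₁ G)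
      maximal = zorn extensions λ C total → let open Chain C total in
        (⋃ , ⋃-isProperFilter , λ h → into (inj₁ h)) ,
        λ G CG h → into (inj₂ (G , CG , h))

    ultrafilter : ∃ λ M → IsUltrafilter M × F ⊆ M
    ultrafilter with maximal
    ... | (M , isM , F⊆M) , max = M , record { isProperFilter = isM ; prime = prime } , F⊆M
      where
      module M = IsProperFilter isM

      prime : ∀ p → M p ⊎ M (∁ p)
      -- If some `u` in `M` is disjoint from `p`, then `∁ p` lies above `u`. Otherwise the filter
      -- `N` generated by `M` and `p` is proper, and maximality of `M` puts `p` into `M`.
      prime p with em {P = ∃ λ u → M u × (u ∧ p) ≤ ⊥}
      ... | yes (u , Mu , u∧p≤⊥) = inj₂ (M.≤-closed (∧≤⊥⇒≤∁ u∧p≤⊥) Mu)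
      ... | no disjoint = inj₁ (proj₁ (max (N , isN , λ h → M⊆N (F⊆M h)) M⊆N)
                                      (⊤ , M.⊤-closed , x∧y≤y ⊤ p))
        where
        N : Pred Carrier ℓ
        N q = ∃ λ u → M u × (u ∧ p) ≤ q

        M⊆N : M ⊆ N
        M⊆N {u} Mu = u , Mu , x∧y≤x u p

        isN : IsProperFilter B N
        isN = record
          { ⊤-closed = M⊆N M.⊤-closed
          ; ∧-closed = λ (u , Mu , u≤) (v , Mv , v≤) → u ∧ v , M.∧-closed Mu Mv ,
              ∧-greatest (≤-trans (∧-mono (x∧y≤x u v) ≤-refl) u≤)
                         (≤-trans (∧-mono (x∧y≤y u v) ≤-refl) v≤)
          ; ≤-closed = λ q≤r (u , Mu , u≤) → u , Mu , ≤-trans u≤ q≤r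
          ; proper   = disjoint
          }

-- Fresh variables

module FreshVariables (em : ∀ {ℓ} → ExcludedMiddle ℓ)
    {ℓ} (X : Set ℓ) (inf : Infinite X) (A : QuantifierAlgebra X (λ _ _ → em))
    (locallyFinite : QuantifierTheory.LocallyFinite A) where
  open QuantifierTheory A public
  open Order (formulas tt) public hiding (_∧_; _≈_; _≤_)
  open Setoid (terms tt) public using ()
    renaming (refl to ≈ᵗ-refl; sym to ≈ᵗ-sym; trans to ≈ᵗ-trans; reflexive to ≈ᵗ-reflexive)

  T : Set ℓ
  T = Term tt

  Φ : Set ℓ
  Φ = Formula tt

  ne : NonEmpty X
  ne = infinite⇒nonEmpty inf

  ⊥ᶠ : Φ
  ⊥ᶠ = BooleanAlgebra.⊥ (formulas tt)

  fresh : ∀ (xs : List X) → ∃ λ y → y ∉ xs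
  fresh xs with em {P = ∃ λ y → y ∉ xs}
  ... | yes y = y
  ... | no ¬y = ⊥-elim (inf (xs , λ x _ → decidable-stable em λ x∉xs → ¬y (x , x∉xs)))

  -- The list that encloses the chosen finite support. It may be larger than the support, but
  -- agreement on it still determines the substitution.
  suppᵗ : T → List X
  suppᵗ t = proj₁ (proj₁ (proj₂ (proj₁ (locallyFinite ne) t)))

  suppᵗ-supports : ∀ t (σ τ : X → T) → (∀ x → x ∈ suppᵗ t → σ x ≈ᵗ τ x) →
                   substᵗ ne t σ ≈ᵗ substᵗ ne t τ
  suppᵗ-supports t σ τ eq = let (_ , (_ , V⊆) , V-supports) = proj₁ (locallyFinite ne) t in
    V-supports σ τ λ x Vx → eq x (V⊆ x Vx)

  suppᶠ : Φ → List X
  suppᶠ p = proj₁ (proj₁ (proj₂ (proj₂ (locallyFinite ne) p)))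

  suppᶠ-supports : ∀ p (σ τ : X → T) → (∀ x → x ∈ suppᶠ p → σ x ≈ᵗ τ x) →
                   substᶠ ne p σ ≈ᶠ substᶠ ne p τ
  suppᶠ-supports p σ τ eq = let (_ , (_ , V⊆) , V-supports) = proj₂ (locallyFinite ne) p in
    V-supports σ τ λ x Vx → eq x (V⊆ x Vx)

  ∈-concatMap : ∀ {a b} {A : Set a} {B : Set b} {f : A → List B} {xs x y} →
                x ∈ xs → y ∈ f x → y ∈ concatMap f xs
  ∈-concatMap {f = f} x∈xs y∈fx = ∈-concatMap⁺ f (Any.map (λ { refl → y∈fx }) x∈xs)

  update-outside : (σ : X → T) (x : X) (d : T) {y : X} → y ≢ x → update σ x d y ≈ᵗ σ y
  update-outside σ x d {y} y≢x with em {P = y ≡ x}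
  ... | yes y≡x = ⊥-elim (y≢x y≡x)
  ... | no _    = ≈ᵗ-refl

  update-cong : ∀ {σ τ : X → T} x d {y} → σ y ≈ᵗ τ y → update σ x d y ≈ᵗ update τ x d y
  update-cong x d {y} eq with em {P = y ≡ x}
  ... | yes _ = ≈ᵗ-refl
  ... | no _  = eq

  update-update : (σ : X → T) (x : X) (d e : T) → update (update σ x d) x e ≗ᵗ update σ x e
  update-update σ x d e y with em {P = y ≡ x}
  ... | yes _  = ≈ᵗ-refl
  ... | no y≢x = update-outside σ x d y≢x

  var-outside : ∀ {y : X} (d : T) xs → y ∉ xs → ∀ x → x ∈ xs → [ d / y ] x ≈ᵗ var x
  var-outside {y} d xs y∉xs x x∈xs = update-outside var y d λ { refl → y∉xs x∈xs }

  freshᵗ : ∀ {y : X} d t → y ∉ suppᵗ t → substᵗ ne t [ d / y ] ≈ᵗ t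
  freshᵗ d t y∉t =
    ≈ᵗ-trans (suppᵗ-supports t _ var (var-outside d (suppᵗ t) y∉t)) (P1ᵗ ne t)

  freshᶠ : ∀ {y : X} d p → y ∉ suppᶠ p → substᶠ ne p [ d / y ] ≈ᶠ p
  freshᶠ d p y∉p =
    ≈-trans (suppᶠ-supports p _ var (var-outside d (suppᶠ p) y∉p)) (P1ᶠ ne p)

  -- The order unfolds to `p ≈ p ∧ q`, so preservation of meets gives monotonicity.
  substᶠ-mono : ∀ {p q : Φ} (σ : X → T) → p ≤ q → substᶠ ne p σ ≤ substᶠ ne q σ
  substᶠ-mono σ p≤q = ≈-trans (substᶠ-cong ne p≤q λ _ → ≈ᵗ-refl) (∧-homo _ _)
    where open BooleanAlgebraHomomorphism (P4 ne σ)

  all-mono : ∀ {p q : Φ} (x : X) → p ≤ q → all x p ≤ all x q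
  all-mono x p≤q = ≈-trans (all-cong x p≤q) (Q1 x _ _)

  -- P5 requires y to be fresh for every value of σ, so σ is first made
  -- constant outside the finite supports of p and ∀x.p.

  -- σ is replaced by τ in `all x p` before P5 and restored in `p` after it, so the two must agree
  -- on both supports.
  scope : X → Φ → List X
  scope x p = suppᶠ p ++ suppᶠ (all x p)

  range : X → Φ → (X → T) → List X
  range x p σ = concatMap (suppᵗ ∘ σ) (scope x p)

  all-subst : ∀ x p (σ : X → T) {y} → y ∉ range x p σ →
              substᶠ ne (all x p) σ ≈ᶠ all y (substᶠ ne p (update σ x (var y)))
  all-subst x p σ {y} y∉ =
    ≈-trans (suppᶠ-supports (all x p) σ τ
              λ v v∈ → σ≈τ v (∈-++⁺ʳ (suppᶠ p) v∈))
   (≈-trans (P5 ne ne x p τ y z (λ y≡z → z∉ (here (sym y≡z))) τ-fresh)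
            (all-cong y (suppᶠ-supports p _ _
              λ v v∈ → update-cong x (var y) (≈ᵗ-sym (σ≈τ v (∈-++⁺ˡ v∈))))))
    where
    z : X
    z = proj₁ (fresh (y ∷ []))

    z∉ : z ∉ (y ∷ [])
    z∉ = proj₂ (fresh (y ∷ []))

    τ : X → T
    τ v with em {P = v ∈ scope x p}
    ... | yes _ = σ v
    -- The default `var z` differs from `var y`, so `[ var z / y ]` leaves it alone. The same `z`
    -- serves as the second variable of P5.
    ... | no _  = var z

    σ≈τ : ∀ v → v ∈ scope x p → σ v ≈ᵗ τ v
    σ≈τ v v∈ with em {P = v ∈ scope x p}
    ... | yes _ = ≈ᵗ-refl
    ... | no v∉ = ⊥-elim (v∉ v∈)

    τ-fresh : compose ne τ [ var z / y ] ≗ᵗ τ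
    τ-fresh v with em {P = v ∈ scope x p}
    ... | yes v∈ = freshᵗ (var z) (σ v) λ y∈ → y∉ (∈-concatMap v∈ y∈)
    ... | no _   = ≈ᵗ-trans (P3 ne z _)
                            (update-outside var y (var z) λ z≡y → z∉ (here z≡y))

  -- The bound variable is renamed to a `y` fresh for both sides. The update of `x` by `var y` then
  -- overwrites `d`, and the two sides coincide.
  all-update : ∀ x p (σ : X → T) d →
               substᶠ ne (all x p) σ ≈ᶠ substᶠ ne (all x p) (update σ x d)
  all-update x p σ d =
    let (y , y∉) = fresh (range x p σ ++ range x p (update σ x d)) in
    ≈-trans (all-subst x p σ (λ y∈ → y∉ (∈-++⁺ˡ y∈)))
   (≈-trans (all-cong y (substᶠ-cong ne ≈-refl λ v → ≈ᵗ-sym (update-update σ x d (var y) v)))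
            (≈-sym (all-subst x p (update σ x d) (λ y∈ → y∉ (∈-++⁺ʳ (range x p σ) y∈)))))

  -- By `all-update` the value at `x` may be changed to `d` under the quantifier, after which Q2 is
  -- substituted.
  all-elim : ∀ x p (σ : X → T) d → substᶠ ne (all x p) σ ≤ substᶠ ne p (update σ x d)
  all-elim x p σ d =
    ≤-trans (≤-reflexive (all-update x p σ d)) (substᶠ-mono (update σ x d) (Q2 x p))

  -- The implication p σ^{d/x} → (∀x.p) σ in terms of meet and complement: `d` is a counterexample
  -- if there is any.
  henkin : X → Φ → (X → T) → T → Φ
  henkin x p σ d = ∁ (substᶠ ne p (update σ x d) ∧ ∁ substᶠ ne (all x p) σ)

  -- If the meet vanished, `g` would lie below the instance at `y` and below the complement of
  -- (∀x.p) σ. As `y` is fresh for `g`, Q3 gives ∀y.g = g. Generalising over `y` therefore places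
  -- `g` below (∀x.p) σ too, so `g` would be zero.
  henkin-consistent : ∀ x p (σ : X → T) g {y} → y ∉ range x p σ → y ∉ suppᶠ g →
                      ¬ (g ≈ᶠ ⊥ᶠ) → ¬ ((g ∧ henkin x p σ (var y)) ≈ᶠ ⊥ᶠ)
  henkin-consistent x p σ g {y} y∉σ y∉g g≉⊥ eq = g≉⊥ (≤⊥⇒≈⊥
    (≤-trans (∧-greatest g≤∀ g≤∁∀) (≤-reflexive (∧-complementʳ _))))
    where
    z : X
    z = proj₁ (fresh (y ∷ []))

    z≢y : z ≢ y
    z≢y z≡y = proj₂ (fresh (y ∷ [])) (here z≡y)

    g≤ : g ≤ (substᶠ ne p (update σ x (var y)) ∧ ∁ substᶠ ne (all x p) σ)
    g≤ = ∧∁≈⊥⇒≤ eq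

    g≤∁∀ : g ≤ (∁ substᶠ ne (all x p) σ)
    g≤∁∀ = ≤-trans g≤ (x∧y≤y _ _)

    g≤∀ : g ≤ substᶠ ne (all x p) σ
    g≤∀ = ≤-trans (≤-reflexive (≈-sym (Q3 ne y z g z≢y (freshᶠ (var z) g y∉g))))
         (≤-trans (all-mono y (≤-trans g≤ (x∧y≤x _ _)))
                  (≤-reflexive (≈-sym (all-subst x p σ y∉σ))))

-- Terms with witnesses

module Henkin (em : ∀ {ℓ} → ExcludedMiddle ℓ)
              (zorn : ∀ {c ℓ₁ ℓ₂ ℓ} → ZornsLemma c ℓ₁ ℓ₂ ℓ)
              {ℓ} (X : Set ℓ) (inf : Infinite X) (A : QuantifierAlgebra X (λ _ _ → em))
              (locallyFinite : QuantifierTheory.LocallyFinite A) where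
  open FreshVariables em X inf A locallyFinite
  private module A = QuantifierTheory A

  -- witness x p σ names an element d with p σ^{d/x} ≤ (∀x.p) σ.

  data D : Set ℓ where
    base    : X → D
    app     : T → (X → D) → D
    witness : X → Φ → (X → D) → D

  W : Set ℓ
  W = X × Φ × (X → D)

  Θ : Set ℓ
  Θ = W → T

  -- A witness is looked up as a whole triple without evaluating its parameters, so its value
  -- depends on `θ` at that one entry only.
  eval : Θ → D → T
  eval θ (base x)        = var x
  eval θ (app t σ)       = substᵗ ne t (λ x → eval θ (σ x))
  eval θ (witness x p σ) = θ (x , p , σ)

  axiom : Θ → W → Φ
  axiom θ w@(x , p , σ) = henkin x p (eval θ ∘ σ) (θ w)

  -- Arranging finitely many witnesses by dependency

  DeterminedBy : List W → D → Set ℓ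
  DeterminedBy L d = ∀ θ θ′ → (∀ w → w ∈ L → θ w ≡ θ′ w) → eval θ d ≈ᵗ eval θ′ d

  determined-mono : ∀ {L L′ d} → L ⊆ˡ L′ → DeterminedBy L d → DeterminedBy L′ d
  determined-mono L⊆L′ det θ θ′ eq = det θ θ′ λ w w∈L → eq w (L⊆L′ w∈L)

  -- Every witness comes after (to the left of) those its axiom refers to.

  data Ordered : List W → Set ℓ where
    []  : Ordered []
    _∷_ : ∀ {x p σ L} → ((x , p , σ) ∉ L) × (∀ v → v ∈ scope x p → DeterminedBy L (σ v)) →
          Ordered L → Ordered ((x , p , σ) ∷ L)

  OrderedExtension : List W → (List W → Set ℓ) → Set ℓ
  OrderedExtension L P = ∃ λ L′ → Ordered L′ × (L ⊆ˡ L′) × P L′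

  -- The initial list is arbitrary so that the lists needed for several parameters can be
  -- accumulated one after another.
  Determinable : D → Set ℓ
  Determinable d = ∀ L → Ordered L → OrderedExtension L λ L′ → DeterminedBy L′ d

  determineAll : (σ : X → D) → (∀ v → Determinable (σ v)) → ∀ xs L → Ordered L →
                 OrderedExtension L λ L′ → ∀ v → v ∈ xs → DeterminedBy L′ (σ v)
  determineAll σ det []       L ord = L , ord , id , λ _ ()
  determineAll σ det (x ∷ xs) L ord =
    let (L₁ , ord₁ , L⊆L₁ , det₁)  = det x L ord
        (L₂ , ord₂ , L₁⊆L₂ , det₂) = determineAll σ det xs L₁ ord₁
    in L₂ , ord₂ , L₁⊆L₂ ∘ L⊆L₁ ,
       λ { v (here refl) → determined-mono {d = σ x} L₁⊆L₂ det₁ ; v (there v∈) → det₂ v v∈ }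

  -- The witnesses behind the parameters in the scope enter first. The new one goes in front of them
  -- unless it is present by then, which keeps the list free of repetitions.
  insert : ∀ x p σ → (∀ v → Determinable (σ v)) → ∀ L → Ordered L →
           OrderedExtension L ((x , p , σ) ∈_)
  insert x p σ det L ord with determineAll σ det (scope x p) L ord
  ... | L₁ , ord₁ , L⊆L₁ , det₁ with em {P = (x , p , σ) ∈ L₁}
  ...   | yes w∈ = L₁ , ord₁ , L⊆L₁ , w∈
  ...   | no w∉  = _ , (w∉ , det₁) ∷ ord₁ , there ∘ L⊆L₁ , here refl

  -- Although `app t σ` has infinitely many subterms, its value depends only on those at `suppᵗ t`,
  -- so a finite list suffices.
  determine : ∀ d → Determinable d
  determine (base x)  L ord = L , ord , id , λ _ _ _ → ≈ᵗ-refl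
  determine (app t σ) L ord =
    let (L′ , ord′ , L⊆L′ , det) = determineAll σ (λ v → determine (σ v)) (suppᵗ t) L ord
    in L′ , ord′ , L⊆L′ , λ θ θ′ eq → suppᵗ-supports t _ _ λ v v∈ → det v v∈ θ θ′ eq
  determine (witness x p σ) L ord =
    let (L′ , ord′ , L⊆L′ , w∈) = insert x p σ (λ v → determine (σ v)) L ord
    in L′ , ord′ , L⊆L′ , λ θ θ′ eq → ≈ᵗ-reflexive (eq _ w∈)

  cover : ∀ L → OrderedExtension [] (L ⊆ˡ_)
  cover []                = [] , [] , id , id
  cover ((x , p , σ) ∷ L) =
    let (L₁ , ord₁ , _ , L⊆L₁)   = cover L
        (L₂ , ord₂ , L₁⊆L₂ , w∈) = insert x p σ (λ v → determine (σ v)) L₁ ord₁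
    in L₂ , ord₂ , (λ ()) , λ { (here refl) → w∈ ; (there w∈L) → L₁⊆L₂ (L⊆L₁ w∈L) }

  -- Joint consistency of finitely many axioms

  henkin-cong : ∀ x p {σ σ′ : X → T} {d d′ : T} →
                (∀ v → v ∈ scope x p → σ v ≈ᵗ σ′ v) → d ≈ᵗ d′ →
                henkin x p σ d ≈ᶠ henkin x p σ′ d′
  henkin-cong x p {σ} {σ′} {d} {d′} σ≈σ′ d≈d′ =
    ∁-cong (∧-cong (suppᶠ-supports p _ _ λ v v∈ → updated v (σ≈σ′ v (∈-++⁺ˡ v∈)))
                   (∁-cong (suppᶠ-supports (all x p) _ _
                              λ v v∈ → σ≈σ′ v (∈-++⁺ʳ (suppᶠ p) v∈))))
    where
    updated : ∀ v → σ v ≈ᵗ σ′ v → update σ x d v ≈ᵗ update σ′ x d′ v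
    updated v eq with em {P = v ≡ x}
    ... | yes _ = d≈d′
    ... | no _  = eq

  assign : Θ → W → T → Θ
  assign θ w d w′ with em {P = w′ ≡ w}
  ... | yes _ = d
  ... | no _  = θ w′

  assign-here : ∀ θ w d → assign θ w d w ≡ d
  assign-here θ w d with em {P = w ≡ w}
  ... | yes _  = refl
  ... | no w≢w = ⊥-elim (w≢w refl)

  assign-there : ∀ θ w d {w′} → w′ ≢ w → assign θ w d w′ ≡ θ w′
  assign-there θ w d {w′} w′≢w with em {P = w′ ≡ w}
  ... | yes w′≡w = ⊥-elim (w′≢w w′≡w)
  ... | no _     = refl

  -- The axiom of the head refers to the head itself and, through its parameters, only to the tail.
  -- The axioms of the tail do not see the head.
  axiom-determined : ∀ {L} → Ordered L → ∀ θ θ′ → (∀ w → w ∈ L → θ w ≡ θ′ w) →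
                     ∀ w → w ∈ L → axiom θ w ≈ᶠ axiom θ′ w
  axiom-determined ((_ , det) ∷ ord) θ θ′ eq w@(x , p , σ) (here refl) =
    henkin-cong x p (λ v v∈ → det v v∈ θ θ′ λ w′ w′∈ → eq w′ (there w′∈))
                (≈ᵗ-reflexive (eq w (here refl)))
  axiom-determined (_ ∷ ord) θ θ′ eq w (there w∈) =
    axiom-determined ord θ θ′ (λ w′ w′∈ → eq w′ (there w′∈)) w w∈

  -- The induction begins with the witnesses on which others depend. The tail provides `θ` and a
  -- nonzero `r`. The head is sent to a variable fresh for `r` and for its parameters, and
  -- `henkin-consistent` keeps the new meet nonzero. The reassignment leaves the axioms of the tail
  -- intact because the head does not occur there.
  axioms-consistent : ∀ {L} → Ordered L → ∀ {g} → ¬ (g ≈ᶠ ⊥ᶠ) →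
    ∃ λ θ → ∃ λ r → ¬ (r ≈ᶠ ⊥ᶠ) × r ≤ g × (∀ w → w ∈ L → r ≤ axiom θ w)
  axioms-consistent [] {g} g≉⊥ =
    -- With no axioms to satisfy any assignment will do; the variable stored in the witness supplies
    -- a term.
    (λ (x , _) → var x) , g , g≉⊥ , ≤-refl , λ _ ()
  axioms-consistent (_∷_ {x} {p} {σ} {L} (w∉L , det) ord) g≉⊥ =
    θ′ , r′ , henkin-consistent x p (eval θ ∘ σ) r y∉range y∉r r≉⊥ ,
    ≤-trans (x∧y≤x _ _) r≤g ,
    λ { w′ (here refl)  → ≤-trans (x∧y≤y _ _) (≤-reflexive
          (henkin-cong x p (λ v v∈ → det v v∈ θ θ′ agree)
                       (≈ᵗ-reflexive (sym (assign-here θ w (var y))))))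
      ; w′ (there w′∈L) → ≤-trans (x∧y≤x _ _) (≤-trans (r≤axiom w′ w′∈L) (≤-reflexive
          (axiom-determined ord θ θ′ agree w′ w′∈L))) }
    where
    w : W
    w = x , p , σ

    IH = axioms-consistent ord g≉⊥
    θ       = proj₁ IH
    r       = proj₁ (proj₂ IH)
    r≉⊥     = proj₁ (proj₂ (proj₂ IH))
    r≤g     = proj₁ (proj₂ (proj₂ (proj₂ IH)))
    r≤axiom = proj₂ (proj₂ (proj₂ (proj₂ IH)))

    freshVariable = fresh (range x p (eval θ ∘ σ) ++ suppᶠ r)
    y = proj₁ freshVariable

    y∉range : y ∉ range x p (eval θ ∘ σ)
    y∉range = proj₂ freshVariable ∘ ∈-++⁺ˡ

    y∉r : y ∉ suppᶠ r
    y∉r = proj₂ freshVariable ∘ ∈-++⁺ʳ (range x p (eval θ ∘ σ))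

    θ′ : Θ
    θ′ = assign θ w (var y)

    r′ : Φ
    r′ = r ∧ henkin x p (eval θ ∘ σ) (var y)

    agree : ∀ w′ → w′ ∈ L → θ w′ ≡ θ′ w′
    agree w′ w′∈L = sym (assign-there θ w (var y) λ { refl → w∉L w′∈L })

  -- The filter generated by the axioms

  Φ^Θ : BooleanAlgebra ℓ ℓ
  Φ^Θ = power Θ (formulas tt)

  module Φ^Θ = Order Φ^Θ
  open Ultrafilter em zorn Φ^Θ

  instantiate : Φ → (X → D) → Θ → Φ
  instantiate p σ θ = substᶠ ne p (eval θ ∘ σ)

  module _ (F : Pred Φ ℓ) (isProperFilter : IsProperFilter (formulas tt) F) where
    private
      module F = IsProperFilter isProperFilter

    -- Membership says that at each `θ` the meet of `g` with the axioms from `L` lies below `f θ`.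
    -- Quantifying over lower bounds `r` avoids forming that finite meet.
    Generated : Pred (Θ → Φ) ℓ
    Generated f = ∃ λ g → F g × ∃ λ L → ∀ θ r →
      r ≤ g → (∀ w → w ∈ L → r ≤ axiom θ w) → r ≤ f θ

    generated-isProperFilter : IsProperFilter Φ^Θ Generated
    generated-isProperFilter = record
      { ⊤-closed = _ , F.⊤-closed , [] , λ _ _ _ _ → ⊤-maximum _
      ; ∧-closed = λ (g , Fg , L , h) (g′ , Fg′ , L′ , h′) →
          g ∧ g′ , F.∧-closed Fg Fg′ , L ++ L′ , λ θ r r≤g∧g′ r≤axiom → ∧-greatest
            (h  θ r (≤-trans r≤g∧g′ (x∧y≤x _ _)) λ w w∈ → r≤axiom w (∈-++⁺ˡ w∈))
            (h′ θ r (≤-trans r≤g∧g′ (x∧y≤y _ _)) λ w w∈ → r≤axiom w (∈-++⁺ʳ L w∈))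
      ; ≤-closed = λ f≤f′ (g , Fg , L , h) →
          g , Fg , L , λ θ r r≤g r≤axiom → ≤-trans (h θ r r≤g r≤axiom) (f≤f′ θ)
      -- The list is enlarged to an ordered one, for which a single `θ` admits a nonzero `r` below
      -- `g` and all the axioms, hence below zero.
      ; proper   = λ (g , Fg , L , h) →
          let (L′ , ord , _ , L⊆L′)     = cover L
              g≉⊥ g≈⊥ = F.proper (F.≤-closed (≤-reflexive g≈⊥) Fg)
              (θ , r , r≉⊥ , r≤g , r≤axiom) = axioms-consistent ord g≉⊥
          in r≉⊥ (≤⊥⇒≈⊥ (h θ r r≤g λ w w∈ → r≤axiom w (L⊆L′ w∈)))
      }

    -- `eval θ ∘ base` is `var` for every `θ`, so the instance is `p` again by P1.
    filter⊆generated : ∀ {p} → F p → Generated (instantiate p base)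
    filter⊆generated {p} Fp = p , Fp , [] , λ θ r r≤p _ →
      ≤-trans r≤p (≤-reflexive (≈-sym (P1ᶠ ne p)))

    axiom∈generated : ∀ w → Generated (λ θ → axiom θ w)
    axiom∈generated w = _ , F.⊤-closed , w ∷ [] , λ θ r _ r≤axiom → r≤axiom w (here refl)

  -- The term model of an ultrafilter

  module TermModel (U : Pred (Θ → Φ) ℓ) (isUltrafilter : IsUltrafilter U)
                   (axiom∈U : ∀ w → U λ θ → axiom θ w) where
    open IsUltrafilter isUltrafilter

    S : Collection ℓ
    S = adjoin∅ (｛ X ｝ λ _ _ → em)

    open Collection S using (Index; Var)

    -- Elements are identified when they have the same value under every assignment, so the laws of
    -- `A` transfer pointwise in `θ`.
    D-setoid : Setoid ℓ ℓ
    D-setoid = record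
      { Carrier = D
      ; _≈_ = λ d e → ∀ θ → eval θ d ≈ᵗ eval θ e
      ; isEquivalence = record
        { refl  = λ _ → ≈ᵗ-refl
        ; sym   = λ p θ → ≈ᵗ-sym (p θ)
        ; trans = λ p q θ → ≈ᵗ-trans (p θ) (q θ)
        }
      }

    termsᴮ : Index → Setoid ℓ ℓ
    termsᴮ (just i) = A.terms (proj₁ i)
    termsᴮ nothing  = D-setoid

    formulasᴮ : Index → BooleanAlgebra ℓ ℓ
    formulasᴮ (just i) = A.formulas (proj₁ i)
    formulasᴮ nothing  = 𝟚

    Termᴮ : Index → Set ℓ
    Termᴮ i = Setoid.Carrier (termsᴮ i)

    Formulaᴮ : Index → Set ℓ
    Formulaᴮ i = BooleanAlgebra.Carrier (formulasᴮ i)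

    ¬nonEmpty∅ : ¬ NonEmpty (Var nothing)
    ¬nonEmpty∅ ne∅ = ne∅ λ ()

    varᴮ : ∀ {i} → Var i → Termᴮ i
    varᴮ {just i} = A.var

    substᵗᴮ : ∀ {i j} → NonEmpty (Var i) → Termᴮ i → (Var i → Termᴮ j) → Termᴮ j
    substᵗᴮ {just i} {just j}  = A.substᵗ
    substᵗᴮ {just i} {nothing} = λ _ → app
    substᵗᴮ {nothing}          = λ ne∅ → ⊥-elim (¬nonEmpty∅ ne∅)

    substᶠᴮ : ∀ {i j} → NonEmpty (Var i) → Formulaᴮ i → (Var i → Termᴮ j) → Formulaᴮ j
    substᶠᴮ {just i} {just j}  = A.substᶠ
    substᶠᴮ {just i} {nothing} = λ _ p σ → χ (instantiate p σ)
    substᶠᴮ {nothing}          = λ ne∅ → ⊥-elim (¬nonEmpty∅ ne∅)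

    allᴮ : ∀ {i} → Var i → Formulaᴮ i → Formulaᴮ i
    allᴮ {just i} = A.all

    structureᴮ : Structure S
    structureᴮ = record
      { terms    = termsᴮ
      ; formulas = formulasᴮ
      ; var      = λ {i} → varᴮ {i}
      ; substᵗ   = λ {i} {j} → substᵗᴮ {i} {j}
      ; substᶠ   = λ {i} {j} → substᶠᴮ {i} {j}
      ; all      = λ {i} → allᴮ {i}
      }

    private module B = Structure structureᴮ

    -- The two updates belong to different structures and are both stuck on the equality test; they
    -- agree once it is decided.
    updateᴬ≗updateᴮ : ∀ (i j : NonEmptyIndex (｛ X ｝ λ _ _ → em)) (σ : X → T) x d y →
                      update σ x d y ≈ᵗ B.update {just i} {just j} σ x d y
    updateᴬ≗updateᴮ i j σ x d y with em {P = y ≡ x}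
    ... | yes _ = ≈ᵗ-refl
    ... | no _  = ≈ᵗ-refl

    eval-update : ∀ (i : NonEmptyIndex (｛ X ｝ λ _ _ → em)) θ (σ : X → D) x d y →
                  eval θ (B.update {just i} {nothing} σ x d y) ≈ᵗ
                  update (eval θ ∘ σ) x (eval θ d) y
    eval-update i θ σ x d y with em {P = y ≡ x}
    ... | yes _ = ≈ᵗ-refl
    ... | no _  = ≈ᵗ-refl

    isQuantifierTheoryᴮ : IsQuantifierTheory structureᴮ
    isQuantifierTheoryᴮ = record
      { substᵗ-cong = λ {i} {j} → substᵗ-congᴮ {i} {j}
      ; substᶠ-cong = λ {i} {j} → substᶠ-congᴮ {i} {j}
      ; all-cong    = λ {i} → all-congᴮ {i}
      ; P1ᵗ = λ {i} → P1ᵗᴮ {i}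
      ; P1ᶠ = λ {i} → P1ᶠᴮ {i}
      ; P2ᵗ = λ {i} {j} {k} → P2ᵗᴮ {i} {j} {k}
      ; P2ᶠ = λ {i} {j} {k} → P2ᶠᴮ {i} {j} {k}
      ; P3  = λ {i} {j} → P3ᴮ {i} {j}
      ; P4  = λ {i} {j} → P4ᴮ {i} {j}
      ; P5  = λ {i} {j} → P5ᴮ {i} {j}
      ; Q1  = λ {i} → Q1ᴮ {i}
      ; Q2  = λ {i} → Q2ᴮ {i}
      ; Q3  = λ {i} → Q3ᴮ {i}
      }
      where
      substᵗ-congᴮ : ∀ {i j} (ne : NonEmpty (Var i)) {t u} {σ τ : Var i → Termᴮ j} →
                     B._≈ᵗ_ {i} t u → B._≗ᵗ_ {i} {j} σ τ →
                     B._≈ᵗ_ {j} (substᵗᴮ {i} {j} ne t σ) (substᵗᴮ {i} {j} ne u τ)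
      substᵗ-congᴮ {just i} {just j}  ne t≈u σ≗τ = A.substᵗ-cong ne t≈u σ≗τ
      substᵗ-congᴮ {just i} {nothing} ne t≈u σ≗τ θ = A.substᵗ-cong ne t≈u λ x → σ≗τ x θ
      substᵗ-congᴮ {nothing} ne∅ = ⊥-elim (¬nonEmpty∅ ne∅)

      substᶠ-congᴮ : ∀ {i j} (ne : NonEmpty (Var i)) {p q} {σ τ : Var i → Termᴮ j} →
                     B._≈ᶠ_ {i} p q → B._≗ᵗ_ {i} {j} σ τ →
                     B._≈ᶠ_ {j} (substᶠᴮ {i} {j} ne p σ) (substᶠᴮ {i} {j} ne q τ)
      substᶠ-congᴮ {just i} {just j}  ne p≈q σ≗τ = A.substᶠ-cong ne p≈q σ≗τ
      substᶠ-congᴮ {just i} {nothing} ne p≈q σ≗τ =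
        χ-cong λ θ → A.substᶠ-cong ne p≈q λ x → σ≗τ x θ
      substᶠ-congᴮ {nothing} ne∅ = ⊥-elim (¬nonEmpty∅ ne∅)

      all-congᴮ : ∀ {i} (x : Var i) {p q} → B._≈ᶠ_ {i} p q →
                  B._≈ᶠ_ {i} (allᴮ {i} x p) (allᴮ {i} x q)
      all-congᴮ {just i} = A.all-cong

      P1ᵗᴮ : ∀ {i} (ne : NonEmpty (Var i)) t →
             B._≈ᵗ_ {i} (substᵗᴮ {i} {i} ne t (varᴮ {i})) t
      P1ᵗᴮ {just i}  = A.P1ᵗ
      P1ᵗᴮ {nothing} ne∅ = ⊥-elim (¬nonEmpty∅ ne∅)

      P1ᶠᴮ : ∀ {i} (ne : NonEmpty (Var i)) p →
             B._≈ᶠ_ {i} (substᶠᴮ {i} {i} ne p (varᴮ {i})) p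
      P1ᶠᴮ {just i}  = A.P1ᶠ
      P1ᶠᴮ {nothing} ne∅ = ⊥-elim (¬nonEmpty∅ ne∅)

      P2ᵗᴮ : ∀ {i j k} (neᵢ : NonEmpty (Var i)) (neⱼ : NonEmpty (Var j))
             t (σ : Var i → Termᴮ j) (τ : Var j → Termᴮ k) →
             B._≈ᵗ_ {k} (substᵗᴮ {j} {k} neⱼ (substᵗᴮ {i} {j} neᵢ t σ) τ)
                        (substᵗᴮ {i} {k} neᵢ t (B.compose {i} {j} {k} neⱼ σ τ))
      P2ᵗᴮ {just i} {just j} {just k}  = A.P2ᵗ
      P2ᵗᴮ {just i} {just j} {nothing} neᵢ neⱼ t σ τ θ = A.P2ᵗ neᵢ neⱼ t σ (eval θ ∘ τ)
      P2ᵗᴮ {just i} {nothing} _ ne∅ = ⊥-elim (¬nonEmpty∅ ne∅)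
      P2ᵗᴮ {nothing} ne∅ = ⊥-elim (¬nonEmpty∅ ne∅)

      P2ᶠᴮ : ∀ {i j k} (neᵢ : NonEmpty (Var i)) (neⱼ : NonEmpty (Var j))
             p (σ : Var i → Termᴮ j) (τ : Var j → Termᴮ k) →
             B._≈ᶠ_ {k} (substᶠᴮ {j} {k} neⱼ (substᶠᴮ {i} {j} neᵢ p σ) τ)
                        (substᶠᴮ {i} {k} neᵢ p (B.compose {i} {j} {k} neⱼ σ τ))
      P2ᶠᴮ {just i} {just j} {just k}  = A.P2ᶠ
      P2ᶠᴮ {just i} {just j} {nothing} neᵢ neⱼ p σ τ =
        χ-cong λ θ → A.P2ᶠ neᵢ neⱼ p σ (eval θ ∘ τ)
      P2ᶠᴮ {just i} {nothing} _ ne∅ = ⊥-elim (¬nonEmpty∅ ne∅)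
      P2ᶠᴮ {nothing} ne∅ = ⊥-elim (¬nonEmpty∅ ne∅)

      P3ᴮ : ∀ {i j} (ne : NonEmpty (Var i)) x (σ : Var i → Termᴮ j) →
            B._≈ᵗ_ {j} (substᵗᴮ {i} {j} ne (varᴮ {i} x) σ) (σ x)
      P3ᴮ {just i} {just j}  = A.P3
      P3ᴮ {just i} {nothing} ne x σ θ = A.P3 ne x (eval θ ∘ σ)

      P4ᴮ : ∀ {i j} (ne : NonEmpty (Var i)) (σ : Var i → Termᴮ j) →
            IsBooleanAlgebraHomomorphism (formulasᴮ i) (formulasᴮ j)
              (λ p → substᶠᴮ {i} {j} ne p σ)
      P4ᴮ {just i} {just j} ne σ = A.P4 ne σ
      P4ᴮ {nothing} ne∅ = ⊥-elim (¬nonEmpty∅ ne∅)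
      -- Substitution into the domain is the homomorphism of P4, taken pointwise in `θ`, followed by
      -- `χ`.
      P4ᴮ {just i} {nothing} ne σ = record
        { isLatticeHomomorphism = record
          { isRelHomomorphism = record
            { cong = λ p≈q → χ-cong λ θ → A.substᶠ-cong ne p≈q λ _ → ≈ᵗ-refl }
          ; ∧-homo = λ p q → 𝟚-trans (χ-cong λ θ → σ.∧-homo θ p q) (χ-∧ _ _)
          ; ∨-homo = λ p q → 𝟚-trans (χ-cong λ θ → σ.∨-homo θ p q) (χ-∨ _ _)
          }
        ; ¬-homo = λ p → 𝟚-trans (χ-cong λ θ → σ.¬-homo θ p) (χ-∁ _)
        ; ⊤-homo = 𝟚-trans (χ-cong λ θ → σ.⊤-homo θ) (χ-true ⊤-closed)
        ; ⊥-homo = 𝟚-trans (χ-cong λ θ → σ.⊥-homo θ) (χ-false proper)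
        }
        where
        module σ θ = BooleanAlgebraHomomorphism (A.P4 ne (eval θ ∘ σ))

        𝟚-trans : ∀ {p q r : 𝟚.Carrier {ℓ}} → p 𝟚.≈ q → q 𝟚.≈ r → p 𝟚.≈ r
        𝟚-trans {p} {q} {r} = 𝟚.≈-trans {i = p} {j = q} {k = r}

      P5ᴮ : ∀ {i j} (neᵢ : NonEmpty (Var i)) (neⱼ : NonEmpty (Var j))
            x p (σ : Var i → Termᴮ j) (y z : Var j) → y ≢ z →
            B._≗ᵗ_ {i} {j} (B.compose {i} {j} {j} neⱼ σ (B.[_/_] {j} (varᴮ {j} z) y)) σ →
            B._≈ᶠ_ {j} (substᶠᴮ {i} {j} neᵢ (allᴮ {i} x p) σ)
              (allᴮ {j} y (substᶠᴮ {i} {j} neᵢ p (B.update {i} {j} σ x (varᴮ {j} y))))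
      -- The target must have variables, so P5 of `A` applies after both the proviso and the
      -- conclusion are moved between the two forms of update.
      P5ᴮ {just i} {just j} neᵢ neⱼ x p σ y z y≢z σ-fresh = ≈-trans
        (A.P5 neᵢ neⱼ x p σ y z y≢z λ v → ≈ᵗ-trans
          (A.substᵗ-cong neⱼ ≈ᵗ-refl (updateᴬ≗updateᴮ j j var y (var z)))
          (σ-fresh v))
        (A.all-cong y (A.substᶠ-cong neᵢ ≈-refl (updateᴬ≗updateᴮ i j σ x (var y))))
      P5ᴮ {just i} {nothing} _ ne∅ = ⊥-elim (¬nonEmpty∅ ne∅)
      P5ᴮ {nothing} ne∅ = ⊥-elim (¬nonEmpty∅ ne∅)

      Q1ᴮ : ∀ {i} (x : Var i) p q →
            B._≈ᶠ_ {i} (allᴮ {i} x (B._∧_ {i} p q)) (B._∧_ {i} (allᴮ {i} x p) (allᴮ {i} x q))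
      Q1ᴮ {just i} = A.Q1

      Q2ᴮ : ∀ {i} (x : Var i) p → B._≤_ {i} (allᴮ {i} x p) p
      Q2ᴮ {just i} = A.Q2

      Q3ᴮ : ∀ {i} (ne : NonEmpty (Var i)) (x y : Var i) p → y ≢ x →
            B._≈ᶠ_ {i} (substᶠᴮ {i} {i} ne p (B.[_/_] {i} (varᴮ {i} y) x)) p →
            B._≈ᶠ_ {i} (allᴮ {i} x p) p
      Q3ᴮ {just i} ne x y p y≢x eq = A.Q3 ne x y p y≢x
        (≈-trans (A.substᶠ-cong ne ≈-refl (updateᴬ≗updateᴮ i i var x (var y))) eq)

    theoryᴮ : QuantifierTheory S
    theoryᴮ = record
      { structure          = structureᴮ
      ; isQuantifierTheory = isQuantifierTheoryᴮ
      ; nontrivial         =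
          -- Being closed in the model also covers substitutions into `X`, so it implies being
          -- closed in `A`.
          let (i , ne , p , ¬closed) = A.nontrivial in
          just (i , ne) , ne , p , λ closed → ¬closed λ σ τ eq → closed {just (i , ne)} σ τ eq
      }

    isQuantifierModelᴮ : IsQuantifierModel theoryᴮ nothing
    isQuantifierModelᴮ = record
      { Var-empty = λ ()
      ; M1ᵗ       = λ ¬D → ne λ x → ¬D (base x)
      ; M1ᶠ       = proj₁ 𝟚-isTwo
      ; M2        = λ {i} → M2ᴮ {i}
      }
      where
      -- The lower bound is `all-elim` pointwise in `θ`. For the greatest one, a true lower bound
      -- makes the instance at the witness `d₀` true, and the axiom of `d₀` passes this on to the
      -- quantified formula.
      M2ᴮ : ∀ {i} (ne : NonEmpty (Var i)) x p (σ : Var i → D) →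
            IsInfimum 𝟚 (λ d → substᶠᴮ {i} {nothing} ne p (B.update {i} {nothing} σ x d))
                        (substᶠᴮ {i} {nothing} ne (allᴮ {i} x p) σ)
      M2ᴮ {just i} ne x p σ =
        (λ d → 𝟚-≤ _ (value d) λ eq → χ-true
          (≤-closed (λ θ → ≤-trans (all-elim x p (eval θ ∘ σ) (eval θ d))
                                   (≤-reflexive (≈-sym (instance-update d θ))))
                    (χ-true⁻¹ eq)) tt) ,
        λ l l≤ → 𝟚-≤ l _ λ eq → χ-true (all∈U (χ-true⁻¹ (value-true l l≤ eq))) tt
        where
        value : D → 𝟚.Carrier {ℓ}
        value d = χ (instantiate p (B.update {just i} {nothing} σ x d))

        d₀ : D
        d₀ = witness x p σ

        instance-update : ∀ d θ → instantiate p (B.update {just i} {nothing} σ x d) θ ≈ᶠ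
                                  substᶠ ne p (update (eval θ ∘ σ) x (eval θ d))
        instance-update d θ = substᶠ-cong ne ≈-refl (eval-update i θ σ x d)

        value-true : ∀ l → (∀ d → l 𝟚.≤ value d) → l tt ≡ true → value d₀ tt ≡ true
        -- Once `l` is true, `l ≤ value d₀` computes to the statement that `value d₀` is true.
        value-true l l≤ eq with l tt | l≤ d₀ tt
        value-true l l≤ refl | .true | eq′ = sym eq′

        all∈U : U (instantiate p (B.update {just i} {nothing} σ x d₀)) → U (instantiate (all x p) σ)
        all∈U p∈U with prime (instantiate (all x p) σ)
        ... | inj₁ all∈ = all∈
        -- The instance and the negated quantified formula would both be in `U`, and the axiom is
        -- the complement of their meet.
        ... | inj₂ ¬all∈ = ⊥-elim (∁-excludes
          (∧-closed (≤-closed (λ θ → ≤-reflexive (instance-update d₀ θ)) p∈U) ¬all∈)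
          (axiom∈U (x , p , σ)))

    twoModel : TwoModel A
    twoModel = record
      { theory            = theoryᴮ
      ; isQuantifierModel = isQuantifierModelᴮ
      ; isTwo             = 𝟚-isTwo
      -- The components at `just i` are those of `A`, so the `subst` in `value` disappears and the
      -- value of `p` reduces to `χ (instantiate p σ)`.
      ; restriction       = refl
      }

  -- Completeness

  model : (F : Pred Φ ℓ) → IsProperFilter (formulas tt) F →
          Σ (TwoModel A) λ B → let open TwoModel B in
          Σ (X → Domain) λ σ →
          ∀ p → (F p → value ne p σ ≈ᵛ 𝟏) × (F (∁ p) → ¬ (value ne p σ ≈ᵛ 𝟏))
  model F isF with ultrafilter (Generated F isF) (generated-isProperFilter F isF)
  ... | U , isU , generated⊆U =
    TermModel.twoModel U isU (λ w → generated⊆U (axiom∈generated F isF w)) , base , λ p →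
    (λ Fp → χ-true (base∈U Fp)) ,
    λ F∁p value≈𝟏 → ∁-excludes (χ-true⁻¹ (value≈𝟏 tt))
      (≤-closed (λ θ → ≤-reflexive (¬-homo θ p)) (base∈U F∁p))
    where
    open IsUltrafilter isU
    open module base θ = BooleanAlgebraHomomorphism (A.P4 ne (eval θ ∘ base)) using (¬-homo)

    base∈U : ∀ {p} → F p → U (instantiate p base)
    base∈U Fp = generated⊆U (filter⊆generated F isF Fp)

  -- The principal filter of `p ∧ ∁ q` contains both `p` and `∁ q`, so its model makes `p` true and
  -- `q` not.
  separate : ∀ {p q} → ¬ ((p ∧ ∁ q) ≈ᶠ ⊥ᶠ) →
             Σ (TwoModel A) λ B → let open TwoModel B in
             Σ (X → Domain) λ σ → ¬ (value ne p σ ≈ᵛ value ne q σ)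
  separate {p} {q} p∧∁q≉⊥ with model (p ∧ ∁ q ≤_) (principal p∧∁q≉⊥)
  ... | B , σ , values = B , σ , λ p≈q → proj₂ (values q) (x∧y≤y p (∁ q))
    (𝕍.trans (𝕍.sym p≈q) (proj₁ (values p) (x∧y≤x p (∁ q))))
    where module 𝕍 = BooleanAlgebra (TwoModel.truthValues B)

theorem8 : (em : ∀ {ℓ} → ExcludedMiddle ℓ) →
    (zorn : ∀ {c ℓ₁ ℓ₂ ℓ} → ZornsLemma c ℓ₁ ℓ₂ ℓ) →
    ∀ {ℓ} (X : Set ℓ) (inf : Infinite X)
    (A : QuantifierAlgebra X (λ _ _ → em)) →
    let open QuantifierTheory A in
    LocallyFinite →
    ((J : Pred (Formula tt) ℓ) → Consistent (formulas tt) J →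
    Σ (TwoModel A) λ B → let open TwoModel B in
    Σ (X → Domain) λ σ →
    ∀ p → J p → value (infinite⇒nonEmpty inf) p σ ≈ᵛ 𝟏)
    ×
    ((p q : Formula tt) → ¬ (p ≈ᶠ q) →
    Σ (TwoModel A) λ B → let open TwoModel B in
    Σ (X → Domain) λ σ →
    ¬ (value (infinite⇒nonEmpty inf) p σ ≈ᵛ value (infinite⇒nonEmpty inf) q σ))
theorem8 em zorn {ℓ} X inf A locallyFinite = partᵃ , partᵇ
  where
  open Henkin em zorn X inf A locallyFinite
  open QuantifierTheory A
  open Order (formulas tt) using (∁_; ∧∁≈⊥⇒≤; ≤-antisym)

  ⊥ᶠ : Formula tt
  ⊥ᶠ = BooleanAlgebra.⊥ (formulas tt)

  partᵃ : (J : Pred (Formula tt) ℓ) → Consistent (formulas tt) J →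
          Σ (TwoModel A) λ B → let open TwoModel B in
          Σ (X → Domain) λ σ →
          ∀ p → J p → value (infinite⇒nonEmpty inf) p σ ≈ᵛ 𝟏
  partᵃ J (F , isF , J⊆F) =
    let (B , σ , values) = model F isF
    in B , σ , λ p Jp → proj₁ (values p) (J⊆F p Jp)

  partᵇ : (p q : Formula tt) → ¬ (p ≈ᶠ q) →
          Σ (TwoModel A) λ B → let open TwoModel B in
          Σ (X → Domain) λ σ →
          ¬ (value (infinite⇒nonEmpty inf) p σ ≈ᵛ value (infinite⇒nonEmpty inf) q σ)
  -- Distinct elements have a nonzero difference in at least one direction; if both vanished, each
  -- would lie below the other.
  partᵇ p q p≉q with em {P = (p ∧ ∁ q) ≈ᶠ ⊥ᶠ} | em {P = (q ∧ ∁ p) ≈ᶠ ⊥ᶠ}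
  ... | no p∧∁q≉⊥  | _          = separate p∧∁q≉⊥
  ... | yes _      | no q∧∁p≉⊥  =
    let (B , σ , q≉p) = separate q∧∁p≉⊥
    in B , σ , λ p≈q → q≉p (BooleanAlgebra.sym (TwoModel.truthValues B) p≈q)
  ... | yes p∧∁q≈⊥ | yes q∧∁p≈⊥ =
    ⊥-elim (p≉q (≤-antisym (∧∁≈⊥⇒≤ p∧∁q≈⊥) (∧∁≈⊥⇒≤ q∧∁p≈⊥)))
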